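{- Let $n\geq 1$, let $u$ and $v$ be two snakeshapes of size $n$, and let $\hat 1$ be the maximal tableau in the poset $(\mathbb{YFT}_n,\preceq)$ of standard Young-Fibonacci tableaux of size $n$. Then Okada's Young-Fibonacci analogue of the Kostka number, $\mathbf K_{u,v}$, is the number of tableaux $t$ of shape $u$ in the interval $[rT_v,\hat 1]$ of $(\mathbb{YFT}_n,\preceq)$.
   Context: **Snakeshapes and lattice.** A snakeshape of size $n$ is a word $u=u_1\cdots u_k$ with letters in $\{1,2\}$ and sum $n$ (the empty word $\emptyset$ for $n=0$), drawn as $k$ bottom-justified columns from left to right, the $i$-th column having $u_i$ boxes; in a single-boxed column the unique box is both bottom and top box. In the Young-Fibonacci lattice, a snakeshape $u$ is covered exactly by: (1) $1u$; (2) the snakeshape obtained by adding a box on top of the first (leftmost) single-boxed column of $u$, if there is one; (3) if $u$ starts with a (maximal) series of two-boxed columns, every snakeshape obtained by inserting a single-boxed column just after one of the columns of this initial series. Write $w\rhd u$ if $w$ covers $u$. **Okada's analogue of Kostka numbers.** These are the coefficients in $\mathbf h_v=\sum_u\mathbf K_{u,v}\,\mathbf s_u$ expressing Okada's analogue of complete symmetric functions in terms of his analogue of Schur functions; they are defined for pairs of snakeshapes of the same size and are determined by $\mathbf K_{\emptyset,\emptyset}=1$ and the recurrences $$\mathbf K_{1u,1v}=\mathbf K_{u,v},\quad \mathbf K_{2u,2v}=\mathbf K_{u,v},\quad \mathbf K_{1u,2v}=0,\quad \mathbf K_{2u,1v}=\sum_{w\rhd u}\mathbf K_{w,v}.$$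 **Tableaux.** A standard Young-Fibonacci tableau of size $n$ is a numbering of a snakeshape of size $n$ with $1,\dots,n$ (each used once) such that in each two-boxed column the top entry is larger than the bottom entry, and the entry in the top box of any column is larger than all entries in the columns to its right. $\mathbb{YFT}_n$ is the set of these. **Row canonical tableau.** $rT_v$ is the tableau of shape $v$ in which the top boxes of all columns (including the boxes of single-boxed columns) are labeled $n,n-1,\dots$ from left to right, and the bottom boxes of the two-boxed columns are labeled $1,2,\dots$ from left to right. **Shifting an entry.** Let $a$ be the bottom entry of a column of $t$ which is not the first column; let $b$ be the entry on top of $a$, if the column of $a$ is two-boxed. A shift of $a$ is possible in the following cases and modifies only the column of $a$ and the column just to its left. (1) The column just to the left of $a$ is single-boxed with entry $c$. Then these columns are replaced by a two-boxed column with bottom $a$ and top $c$, followed (if $b$ exists) by a single-boxed column $b$. (2) The column just to the left of $a$ is two-boxed with bottom $c$ and top $d$, and $a<c$. If $b$ exists and $c<b$, the two columns are replaced by the two-boxed column (bottom $a$, top $d$) followed by the two-boxed column (bottom $c$, top $b$). Otherwise they are replaced by the two-boxed column (bottom $a$, top $d$), followed by a single-boxed column $c$, followed (if $b$ exists) by a single-boxed column $b$. **Order.** $t\preceq t'$ if there is a sequence $t_0=t,t_1,\dots,t_k=t'$ ($k\ge0$) in $\mathbb{YFT}_n$ such that $t_{i+1}$ is obtained from $t_i$ by shifting an entry, for $0\le i\le k-1$. This is a partial order on $\mathbb{YFT}_n$ and it has a greatest element $\hat1$. The interval $[s,s']$ is $\{t: s\preceq t\preceq s'\}$. -}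

module Defs where

open import Data.List.Base using (List; []; _∷_; _++_; map; sum; length; upTo; applyUpTo)
open import Data.List.Properties using (map-applyUpTo)
open import Data.List.Membership.Propositional using (_∈_)
open import Data.List.Relation.Binary.Permutation.Propositional
  using (_↭_; prep; swap; ↭-refl; ↭-sym; ↭-trans; ↭-reflexive)
open import Data.List.Relation.Binary.Permutation.Propositional.Properties using (All-resp-↭)
open import Data.List.Relation.Unary.All using (All)
open import Data.List.Relation.Unary.All.Properties using (applyUpTo⁺₁)
open import Data.List.Relation.Unary.Unique.Propositional using (Unique)
open import Data.Nat.Base using (ℕ; zero; suc; pred; _+_; _<_; _≮_; s≤s)
open import Data.Nat.Properties using (+-suc; +-identityʳ; +-monoʳ-<; m≤m+n)
open import Data.Product.Base using (Σ-syntax; _×_; _,_)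
open import Data.Unit.Base using (⊤; tt)
open import Function.Bundles using (_⇔_)
open import Level using (_⊔_)
open import Relation.Binary.Construct.Closure.ReflexiveTransitive using (Star)
open import Relation.Binary.PropositionalEquality using (_≡_; refl; sym; cong; subst)

infixr 5 1∷_ 2∷_

-- Indexed by the sum of the letters.
data Snakeshape : ℕ → Set where
  ∅   : Snakeshape 0
  1∷_ : ∀ {n} → Snakeshape n → Snakeshape (1 + n)
  2∷_ : ∀ {n} → Snakeshape n → Snakeshape (2 + n)

addBox : ∀ {n} → Snakeshape n → List (Snakeshape (suc n))
addBox ∅      = []
addBox (1∷ u) = (2∷ u) ∷ []
addBox (2∷ u) = map 2∷_ (addBox u)

insertions : ∀ {n} → Snakeshape n → List (Snakeshape (suc n))
insertions ∅      = []
insertions (1∷ u) = []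
insertions (2∷ u) = (2∷ 1∷ u) ∷ map 2∷_ (insertions u)

-- All w ▷ u, each listed once: for u = 2ᵏ1r the members are 2ⁱ1(2ᵏ⁻ⁱ1r) for
-- 0 ≤ i ≤ k (told apart by their first 1) and 2ᵏ⁺¹r, which has one column fewer;
-- for u = 2ᵏ they are 2ⁱ12ᵏ⁻ⁱ.
covers : ∀ {n} → Snakeshape n → List (Snakeshape (suc n))
covers u = (1∷ u) ∷ addBox u ++ insertions u

K : ∀ {n} → Snakeshape n → Snakeshape n → ℕ
K ∅      ∅      = 1
K (1∷ u) (1∷ v) = K u v
K (2∷ u) (2∷ v) = K u v
K (1∷ u) (2∷ v) = 0
K (2∷ u) (1∷ v) = sum (map (λ w → K w v) (covers u))

-- Arbitrary numberings of snakeshapes of size n, columns from left to right.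
data Filling : ℕ → Set where
  empty  : Filling 0
  single : ∀ {n} → ℕ → Filling n → Filling (1 + n)
  double : ∀ {n} → (bottom top : ℕ) → Filling n → Filling (2 + n)

shapeOf : ∀ {n} → Filling n → Snakeshape n
shapeOf empty          = ∅
shapeOf (single _ t)   = 1∷ shapeOf t
shapeOf (double _ _ t) = 2∷ shapeOf t

entries : ∀ {n} → Filling n → List ℕ
entries empty          = []
entries (single a t)   = a ∷ entries t
entries (double a b t) = a ∷ b ∷ entries t

Ordered : ∀ {n} → Filling n → Set
Ordered empty          = ⊤
Ordered (single a t)   = All (_< a) (entries t) × Ordered t
Ordered (double a b t) = a < b × All (_< b) (entries t) × Ordered t

IsStandard : ∀ {n} → Filling n → Set
IsStandard {n} t = entries t ↭ map suc (upTo n) × Ordered t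

-- The proof is irrelevant, so tableaux with the same numbering are equal.
record YFT (n : ℕ) : Set where
  constructor tableau
  field
    filling   : Filling n
    .standard : IsStandard filling

open YFT public

shape : ∀ {n} → YFT n → Snakeshape n
shape t = shapeOf (filling t)

infix 4 _⟶_ _⪯_ _∈[_,_]

-- a is the shifted entry, and b the entry on top of it, if any.
data _⟶_ : ∀ {n} → Filling n → Filling n → Set where
  single-single : ∀ {n c a} {t : Filling n} →
    single c (single a t) ⟶ double a c t
  single-double : ∀ {n c a b} {t : Filling n} →
    single c (double a b t) ⟶ double a c (single b t)
  double-single : ∀ {n c d a} {t : Filling n} → a < c →
    double c d (single a t) ⟶ double a d (single c t)
  double-double-< : ∀ {n c d a b} {t : Filling n} → a < c → c < b →
    double c d (double a b t) ⟶ double a d (double c b t)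
  double-double-≮ : ∀ {n c d a b} {t : Filling n} → a < c → c ≮ b →
    double c d (double a b t) ⟶ double a d (single c (single b t))
  under-single : ∀ {n a} {t t′ : Filling n} → t ⟶ t′ →
    single a t ⟶ single a t′
  under-double : ∀ {n a b} {t t′ : Filling n} → t ⟶ t′ →
    double a b t ⟶ double a b t′

-- Every intermediate numbering is required to be a standard tableau.
_⪯_ : ∀ {n} → YFT n → YFT n → Set
_⪯_ = Star (λ t t′ → filling t ⟶ filling t′)

_∈[_,_] : ∀ {n} → YFT n → YFT n → YFT n → Set
t ∈[ s , s′ ] = s ⪯ t × t ⪯ s′

-- top and bottom are the next labels to be used in the top boxes and in the
-- bottom boxes of two-boxed columns.
rowFilling : ∀ {n} → (top bottom : ℕ) → Snakeshape n → Filling n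
rowFilling top bottom ∅      = empty
rowFilling top bottom (1∷ v) = single top (rowFilling (pred top) bottom v)
rowFilling top bottom (2∷ v) = double bottom top (rowFilling (pred top) (suc bottom) v)

private
  range : ℕ → ℕ → List ℕ
  range j m = applyUpTo (λ i → suc (j + i)) m

  range-suc : ∀ j m → range j (suc m) ≡ suc j ∷ range (suc j) m
  range-suc j m = helper
    where
    applyUpTo-cong : ∀ {f g : ℕ → ℕ} → (∀ i → f i ≡ g i) → ∀ k → applyUpTo f k ≡ applyUpTo g k
    applyUpTo-cong f≗g zero    = refl
    applyUpTo-cong {f} {g} f≗g (suc k)
      rewrite f≗g 0 | applyUpTo-cong {λ i → f (suc i)} {λ i → g (suc i)} (λ i → f≗g (suc i)) k = refl

    helper : range j (suc m) ≡ suc j ∷ range (suc j) m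
    helper rewrite +-identityʳ j = cong (suc j ∷_) (applyUpTo-cong (λ i → cong suc (+-suc j i)) m)

  range-last : ∀ j m → range j (suc m) ↭ (j + suc m) ∷ range j m
  range-last j zero    = ↭-reflexive (cong (_∷ []) (sym (+-suc j 0)))
  range-last j (suc m)
    rewrite range-suc j (suc m) | range-suc j m | +-suc j (suc m) =
    ↭-trans (prep (suc j) (range-last (suc j) m)) (swap (suc j) (suc j + suc m) ↭-refl)

  row-entries : ∀ {m} j (v : Snakeshape m) → entries (rowFilling (j + m) (suc j) v) ↭ range j m
  row-entries j ∅ = ↭-refl
  row-entries {suc m} j (1∷ v) = ↭-trans
    (prep (j + suc m)
      (subst (λ k → entries (rowFilling (pred k) (suc j) v) ↭ range j m)
        (sym (+-suc j m)) (row-entries j v)))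
    (↭-sym (range-last j m))
  row-entries {suc (suc m)} j (2∷ v)
    rewrite range-suc j (suc m) | +-suc j (suc m) | +-suc j m =
    prep (suc j)
      (↭-trans (prep (suc (suc (j + m))) (row-entries (suc j) v))
        (subst (λ k → suc k ∷ range (suc j) m ↭ range (suc j) (suc m)) (+-suc j m)
          (↭-sym (range-last (suc j) m))))

  range-< : ∀ j m → All (_< j + suc m) (range j m)
  range-< j m rewrite +-suc j m = applyUpTo⁺₁ _ m (λ i<m → s≤s (+-monoʳ-< j i<m))

  row-< : ∀ {m} j (v : Snakeshape m) → All (_< j + suc m) (entries (rowFilling (j + m) (suc j) v))
  row-< {m} j v = All-resp-↭ (↭-sym (row-entries j v)) (range-< j m)

  row-ordered : ∀ {m} j (v : Snakeshape m) → Ordered (rowFilling (j + m) (suc j) v)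
  row-ordered j ∅ = tt
  row-ordered {suc m} j (1∷ v) =
      subst (λ k → All (_< k) (entries (rowFilling (pred k) (suc j) v))) (sym (+-suc j m))
        (subst (λ k → All (_< k) (entries (rowFilling (j + m) (suc j) v))) (+-suc j m) (row-< j v))
    , subst (λ k → Ordered (rowFilling (pred k) (suc j) v)) (sym (+-suc j m)) (row-ordered j v)
  row-ordered {suc (suc m)} j (2∷ v)
    rewrite +-suc j (suc m) | +-suc j m =
      s≤s (s≤s (m≤m+n j m))
    , subst (λ k → All (_< k) (entries (rowFilling (suc j + m) (suc (suc j)) v)))
        (cong suc (+-suc j m)) (row-< (suc j) v)
    , row-ordered (suc j) v

rowFilling-standard : ∀ {n} (v : Snakeshape n) → IsStandard (rowFilling n 1 v)
rowFilling-standard {n} v =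
  ( ↭-trans (row-entries 0 v) (↭-reflexive (sym (map-applyUpTo (λ i → i) suc n)))
  , row-ordered 0 v )

rT : ∀ {n} → Snakeshape n → YFT n
rT {n} v = tableau (rowFilling n 1 v) (rowFilling-standard v)

-- "The number of x : A satisfying P is k".
Count : ∀ {a p} {A : Set a} → (A → Set p) → ℕ → Set (a ⊔ p)
Count {A = A} P k =
  Σ[ xs ∈ List A ] Unique xs × (∀ x → x ∈ xs ⇔ P x) × length xs ≡ k

{-# OPTIONS --safe #-}
-- Contracting the first column of a tableau t gives a tableau with one box
-- less: a single box is deleted, and the bottom entry of a two-boxed column is
-- inserted into the rest, pushing the bottom entries of the initial two-boxed
-- columns one column to the right until one of them forms a single-boxed column.
-- Contraction is monotone, and putting the top entry m of t as a single column
-- in front of its contraction gives a tableau below t.  So t lies above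
-- single m r exactly when its contraction lies above r, and contraction is a
-- bijection from the tableaux of shape 2u onto those whose shape covers u:
-- this is the recurrence for K (2u) (1v).  If rT v starts with a two-boxed
-- column, the bottom entry of that column is minimal, so no shift ever changes
-- it.
module Submission where

open import Defs
open import Data.Empty using (⊥-elim)
open import Data.List.Base using (List; []; _∷_; _++_; map; length)
open import Data.List.Membership.Propositional using (_∈_)
open import Data.List.Membership.Propositional.Properties
  using (∈-map⁺; ∈-map⁻; ∈-++⁺ˡ; ∈-++⁺ʳ; ∈-++⁻)
open import Data.List.Properties using (length-++; map-++)
open import Data.List.Relation.Binary.Permutation.Propositional
  using (_↭_; prep; swap; ↭-refl; ↭-sym; ↭-trans; ↭-reflexive; ↭⇒↭ₛ)
open import Data.List.Relation.Binary.Permutation.Propositional.Properties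
  using (All-resp-↭; ∈-resp-↭; shift)
import Data.List.Relation.Binary.Permutation.Setoid.Properties as Permutationₛ
open import Data.List.Relation.Unary.All as All using (All; []; _∷_)
import Data.List.Relation.Unary.All.Properties as All
open import Data.List.Relation.Unary.Any using (here; there)
open import Data.List.Relation.Unary.Unique.Propositional using (Unique; []; _∷_)
import Data.List.Relation.Unary.Unique.Propositional.Properties as Unique
open import Data.Nat.Base using (ℕ; zero; suc; _+_; _≤_; _<_; _≮_; _≥_; s≤s)
open import Data.Nat.ListAction using (sum)
open import Data.Nat.Properties
  using (_<?_; <-trans; <⇒≯; ≤⇒≯; ≮⇒≥; ≤∧≢⇒<; ≤-refl; <⇒≤;
         m≤m+n; +-suc; m≤n⇒m≤1+n; suc-injective)
open import Data.Product.Base using (Σ-syntax; ∃-syntax; _×_; _,_; proj₁; proj₂)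
open import Data.Sum.Base using ([_,_]′)
open import Data.Unit.Base using (⊤; tt)
open import Function.Base using (_∘_)
open import Function.Bundles using (mk⇔; Equivalence)
open import Relation.Binary.Construct.Closure.ReflexiveTransitive
  using (Star; ε; _◅_; _◅◅_; gmap)
open import Relation.Binary.Definitions using (Maximum)
open import Relation.Binary.PropositionalEquality
  using (_≡_; _≢_; refl; sym; trans; cong; cong₂; subst; setoid)
open import Relation.Nullary.Decidable.Core using (yes; no)
open import Relation.Nullary.Negation.Core using (¬_)

private
  variable
    n : ℕ

-- Counting

module _ {a p} {A : Set a} {P : A → Set p} where

  count-∅ : (∀ x → ¬ P x) → Count P 0
  count-∅ ¬P = [] , [] , (λ x → mk⇔ (λ ()) (λ p → ⊥-elim (¬P x p))) , refl

  -- A relation covers both bijections given as functions of the source (`single m`) and of the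
  -- target (`contract`). Uniqueness of `y` may use `Q`, as `contract` is injective only once shape
  -- and top entry are fixed.
  count-transport : ∀ {b q r} {B : Set b} {Q : B → Set q} (R : A → B → Set r) →
    (∀ {x x′ y} → R x y → R x′ y → x ≡ x′) →
    (∀ {x y y′} → R x y → R x y′ → Q y → Q y′ → y ≡ y′) →
    (∀ {x} → P x → ∃[ y ] Q y × R x y) →
    (∀ {y} → Q y → ∃[ x ] P x × R x y) →
    ∀ {k} → Count P k → Count Q k
  count-transport {B = B} {Q} R x-unique y-unique to from (xs , xs! , xs⇔P , refl) =
    let ys , length-ys , ys! , sound , complete = images xs xs! (All.tabulate (xs⇔P _ .Equivalence.to))
    in ys , ys!
       , (λ y → mk⇔ (proj₁ ∘ sound)
           (λ q → let x , p , r = from q in complete q (xs⇔P x .Equivalence.from p) r))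
       , length-ys
    where
    images : ∀ xs → Unique xs → All P xs → Σ[ ys ∈ List B ]
      length ys ≡ length xs ×
      Unique ys ×
      (∀ {y} → y ∈ ys → Q y × ∃[ x ] x ∈ xs × R x y) ×
      (∀ {x y} → Q y → x ∈ xs → R x y → y ∈ ys)
    images [] [] [] = [] , refl , [] , (λ ()) , (λ _ ())
    images (x ∷ xs) (x∉xs ∷ xs!) (p ∷ ps) =
      let ys , length-ys , ys! , sound , complete = images xs xs! ps
          y , q , r = to p
      in y ∷ ys
       , cong suc length-ys
       , All.tabulate (λ { y′∈ys refl →
           let _ , x′ , x′∈xs , r′ = sound y′∈ys
           in All.lookup x∉xs x′∈xs (x-unique r r′) }) ∷ ys!
       , (λ { (here refl) → q , x , here refl , r
            ; (there y′∈ys) → let q′ , x′ , x′∈xs , r′ = sound y′∈ys in q′ , x′ , there x′∈xs , r′ })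
       , (λ { q′ (here refl) r′ → here (y-unique r′ r q′ q)
            ; q′ (there x∈xs) r′ → there (complete q′ x∈xs r′) })

  -- The lists for distinct `y` are disjoint, so they can be concatenated. With `g` the shape and
  -- `ys` the covers of `u` this gives the sum in the recurrence for `K`.
  count-fibres : ∀ {b} {B : Set b} (g : A → B) {k : B → ℕ} →
    (∀ y → Count (λ x → g x ≡ y × P x) (k y)) →
    ∀ {ys} → Unique ys → Count (λ x → g x ∈ ys × P x) (sum (map k ys))
  count-fibres g fibre [] = [] , [] , (λ x → mk⇔ (λ ()) (λ { (() , _) })) , refl
  count-fibres g fibre {y ∷ ys} (y∉ys ∷ ys!) =
    let xs , xs! , xs⇔ , length-xs = fibre y
        zs , zs! , zs⇔ , length-zs = count-fibres g fibre ys!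
    in xs ++ zs
     , Unique.++⁺ xs! zs! (λ { {x} (x∈xs , x∈zs) →
         All.lookup y∉ys (proj₁ (zs⇔ x .Equivalence.to x∈zs)) (sym (proj₁ (xs⇔ x .Equivalence.to x∈xs))) })
     , (λ x → mk⇔
         (λ x∈ → [ (λ x∈xs → let gx≡y , p = xs⇔ x .Equivalence.to x∈xs in here gx≡y , p)
                , (λ x∈zs → let gx∈ys , p = zs⇔ x .Equivalence.to x∈zs in there gx∈ys , p)
                ]′ (∈-++⁻ xs x∈))
         (λ { (here gx≡y , p) → ∈-++⁺ˡ (xs⇔ x .Equivalence.from (gx≡y , p))
            ; (there gx∈ys , p) → ∈-++⁺ʳ xs (zs⇔ x .Equivalence.from (gx∈ys , p)) }))
     , trans (length-++ xs) (cong₂ _+_ length-xs length-zs)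

-- Covers

infix 4 _▷_

-- Past the initial two-boxed columns, `1∷▷` inserts a single box and `2∷▷1∷` adds a box. The
-- recursion is that of `insert`.
data _▷_ : Snakeshape (suc n) → Snakeshape n → Set where
  1∷▷  : {u : Snakeshape n} → 1∷ u ▷ u
  2∷▷1∷ : {u : Snakeshape n} → 2∷ u ▷ 1∷ u
  2∷▷2∷ : {w : Snakeshape (suc n)} {u : Snakeshape n} → w ▷ u → 2∷ w ▷ 2∷ u

-- `2∷ 1∷ u`, the head of `insertions (2∷ u)`, is the image of the cover `1∷ u`; moved forward, it
-- completes the image of `covers u`.
covers-2∷ : (u : Snakeshape n) → covers (2∷ u) ↭ (1∷ 2∷ u) ∷ map 2∷_ (covers u)
covers-2∷ u = prep (1∷ 2∷ u) (↭-trans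
  (shift (2∷ 1∷ u) (map 2∷_ (addBox u)) (map 2∷_ (insertions u)))
  (prep (2∷ 1∷ u) (↭-reflexive (sym (map-++ 2∷_ (addBox u) (insertions u))))))

▷⇒∈covers : {w : Snakeshape (suc n)} {u : Snakeshape n} → w ▷ u → w ∈ covers u
▷⇒∈covers 1∷▷ = here refl
▷⇒∈covers 2∷▷1∷ = there (here refl)
▷⇒∈covers {u = 2∷ u} (2∷▷2∷ w▷u) =
  ∈-resp-↭ (↭-sym (covers-2∷ u)) (there (∈-map⁺ 2∷_ (▷⇒∈covers w▷u)))

∈covers⇒▷ : {w : Snakeshape (suc n)} {u : Snakeshape n} → w ∈ covers u → w ▷ u
∈covers⇒▷ {u = ∅} (here refl) = 1∷▷
∈covers⇒▷ {u = 1∷ u} (here refl) = 1∷▷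
∈covers⇒▷ {u = 1∷ u} (there (here refl)) = 2∷▷1∷
∈covers⇒▷ {u = 2∷ u} w∈ with ∈-resp-↭ (covers-2∷ u) w∈
... | here refl = 1∷▷
... | there w∈′ with ∈-map⁻ 2∷_ w∈′
...   | _ , w′∈ , refl = 2∷▷2∷ (∈covers⇒▷ w′∈)

unique-resp-↭ : ∀ {a} {A : Set a} {xs ys : List A} → xs ↭ ys → Unique xs → Unique ys
unique-resp-↭ xs↭ys = Permutationₛ.Unique-resp-↭ (setoid _) (↭⇒↭ₛ xs↭ys)

covers-unique : (u : Snakeshape n) → Unique (covers u)
covers-unique ∅      = [] ∷ []
covers-unique (1∷ u) = ((λ ()) ∷ []) ∷ [] ∷ []
covers-unique (2∷ u) = unique-resp-↭ (↭-sym (covers-2∷ u))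
  (All.map⁺ (All.tabulate (λ _ ())) ∷ Unique.map⁺ (λ { refl → refl }) (covers-unique u))

-- Shifts

infix 4 _⟶*_

_⟶*_ : Filling n → Filling n → Set
_⟶*_ = Star _⟶_

reverse₃ : ∀ (x y z : ℕ) {xs} → x ∷ y ∷ z ∷ xs ↭ z ∷ y ∷ x ∷ xs
reverse₃ x y z = ↭-trans (shift z (x ∷ y ∷ []) _) (prep z (swap x y ↭-refl))

⟶-entries : {t t′ : Filling n} → t ⟶ t′ → entries t ↭ entries t′
⟶-entries (single-single {c = c} {a}) = swap c a ↭-refl
⟶-entries (single-double {c = c} {a}) = swap c a ↭-refl
⟶-entries (double-single {c = c} {d} {a} _) = reverse₃ c d a
⟶-entries (double-double-< {c = c} {d} {a} _ _) = reverse₃ c d a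
⟶-entries (double-double-≮ {c = c} {d} {a} _ _) = reverse₃ c d a
⟶-entries (under-single {a = a} s) = prep a (⟶-entries s)
⟶-entries (under-double {a = a} {b} s) = prep a (prep b (⟶-entries s))

-- Distinct entries are needed when c ≮ b makes c and b two single boxes.
⟶-ordered : {t t′ : Filling n} → t ⟶ t′ → Unique (entries t) → Ordered t → Ordered t′
⟶-ordered single-single _ (a<c ∷ t<c , t<a , o) = a<c , t<c , o
⟶-ordered single-double _ (a<c ∷ b<c ∷ t<c , a<b , t<b , o) = a<c , b<c ∷ t<c , t<b , o
⟶-ordered (double-single a<c) _ (c<d , a<d ∷ t<d , t<a , o) =
  a<d , c<d ∷ t<d , All.map (λ x<a → <-trans x<a a<c) t<a , o
⟶-ordered (double-double-< _ c<b) _ (c<d , a<d ∷ b<d ∷ t<d , a<b , t<b , o) =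
  a<d , c<d ∷ b<d ∷ t<d , c<b , t<b , o
⟶-ordered (double-double-≮ _ c≮b) ((_ ∷ _ ∷ c≢b ∷ _) ∷ _) (c<d , a<d ∷ b<d ∷ t<d , a<b , t<b , o) =
  let b<c = ≤∧≢⇒< (≮⇒≥ c≮b) (c≢b ∘ sym)
  in a<d , c<d ∷ b<d ∷ t<d , b<c ∷ All.map (λ x<b → <-trans x<b b<c) t<b , t<b , o
⟶-ordered (under-single s) (_ ∷ t!) (t<a , o) =
  All-resp-↭ (⟶-entries s) t<a , ⟶-ordered s t! o
⟶-ordered (under-double s) (_ ∷ _ ∷ t!) (a<b , t<b , o) =
  a<b , All-resp-↭ (⟶-entries s) t<b , ⟶-ordered s t! o

-- Standardness freed from the labels 1 to n, so that it passes to the tail of a tableau.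
Proper : Filling n → Set
Proper t = Unique (entries t) × Ordered t

⟶-proper : {t t′ : Filling n} → t ⟶ t′ → Proper t → Proper t′
⟶-proper s (t! , o) = unique-resp-↭ (⟶-entries s) t! , ⟶-ordered s t! o

⟶*-proper : {t t′ : Filling n} → t ⟶* t′ → Proper t → Proper t′
⟶*-proper ε        p = p
⟶*-proper (s ◅ ss) p = ⟶*-proper ss (⟶-proper s p)

standard⇒proper : {t : Filling n} → IsStandard t → Proper t
standard⇒proper {n} (perm , o) =
  unique-resp-↭ (↭-sym perm) (Unique.map⁺ suc-injective (Unique.upTo⁺ n)) , o

⟶-standard : {t t′ : Filling n} → t ⟶ t′ → IsStandard t → IsStandard t′
⟶-standard s std@(perm , o) =
  ↭-trans (↭-sym (⟶-entries s)) perm , ⟶-ordered s (proj₁ (standard⇒proper std)) o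

-- Shifts preserve standardness, so a chain of fillings that starts at a tableau lifts to a chain of
-- tableaux.
⟶*⇒⪯ : (s : YFT n) {t : Filling n} → filling s ⟶* t → ∃[ t′ ] filling t′ ≡ t × s ⪯ t′
⟶*⇒⪯ s ε = s , refl , ε
⟶*⇒⪯ (tableau _ std) (_◅_ {j = t} step steps) =
  let t′ , eq , chain = ⟶*⇒⪯ (tableau t (⟶-standard step std)) steps
  in t′ , eq , step ◅ chain

⪯⇒⟶* : {s t : YFT n} → s ⪯ t → filling s ⟶* filling t
⪯⇒⟶* = gmap filling (λ step → step)

-- Contraction of the first column

top : Filling (suc n) → ℕ
top (single a _)   = a
top (double _ b _) = b

-- In an ordered `t` the largest entry is `top t`: a smaller `a` fits below it, and a larger one can
-- stand alone in front of `t`.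
insert : ℕ → Filling n → Filling (suc n)
contract : Filling (suc n) → Filling n

insert {zero}  a t = single a t
insert {suc _} a t with a <? top t
... | yes _ = double a (top t) (contract t)
... | no  _ = single a t

contract (single _ t)   = t
contract (double a _ t) = insert a t

insert-< : ∀ {a} {t : Filling (suc n)} → a < top t → insert a t ≡ double a (top t) (contract t)
insert-< {a = a} {t} a<t with a <? top t
... | yes _ = refl
... | no a≮t = ⊥-elim (a≮t a<t)

insert-≮ : ∀ {a} {t : Filling (suc n)} → a ≮ top t → insert a t ≡ single a t
insert-≮ {a = a} {t} a≮t with a <? top t
... | yes a<t = ⊥-elim (a≮t a<t)
... | no _ = refl

insert-> : ∀ {a} {t : Filling n} → All (_< a) (entries t) → insert a t ≡ single a t
insert-> {t = empty} _ = refl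
insert-> {t = single _ _} (b<a ∷ _) = insert-≮ (<⇒≯ b<a)
insert-> {t = double _ _ _} (_ ∷ b<a ∷ _) = insert-≮ (<⇒≯ b<a)

⟶-top : {t t′ : Filling (suc n)} → t ⟶ t′ → top t ≡ top t′
⟶-top single-single = refl
⟶-top single-double = refl
⟶-top (double-single _) = refl
⟶-top (double-double-< _ _) = refl
⟶-top (double-double-≮ _ _) = refl
⟶-top (under-single _) = refl
⟶-top (under-double _) = refl

⟶*-top : {t t′ : Filling (suc n)} → t ⟶* t′ → top t ≡ top t′
⟶*-top ε        = refl
⟶*-top (s ◅ ss) = trans (⟶-top s) (⟶*-top ss)

-- Once `a` is shifted left, `single (top t) (contract t)` remains behind it: the same situation one
-- column further right.
single-contract-⟶* : (t : Filling (suc n)) → single (top t) (contract t) ⟶* t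
single-contract-⟶* (single _ _) = ε
single-contract-⟶* {suc zero} (double _ _ _) = single-single ◅ ε
single-contract-⟶* {suc (suc _)} (double a _ t) with a <? top t
... | yes _ = single-double ◅ gmap (double a _) under-double (single-contract-⟶* t)
... | no  _ = single-single ◅ ε

-- Its two fillings are the contractions of the two sides of a `double-double-<` shift.
insert-exchange : ∀ {a b c} (t : Filling n) → a < c →
  double c b (insert a t) ⟶* double a b (insert c t)
insert-exchange {zero} _ a<c = double-single a<c ◅ ε
insert-exchange {suc _} {a} {b} {c} t a<c with a <? top t | c <? top t
... | yes _   | yes c<t = double-double-< a<c c<t ◅ ε
-- The shift leaves `single (top t) (contract t)` behind `c`, which shifts back to `t`.
... | yes _   | no c≮t  = double-double-≮ a<c c≮t ◅
  gmap (double a b ∘ single c) (under-double ∘ under-single) (single-contract-⟶* t)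
... | no a≮t  | yes c<t = ⊥-elim (a≮t (<-trans a<c c<t))
... | no _    | no _    = double-single a<c ◅ ε

insert-mono : ∀ a {t t′ : Filling n} → t ⟶ t′ → Ordered t → insert a t ⟶* insert a t′
-- Contraction turns `single-single` and `single-double` into equalities, and `double-single` and
-- `double-double-≮` into `single-single` and `single-double`.
contract-mono : {t t′ : Filling (suc n)} → t ⟶ t′ → Ordered t → contract t ⟶* contract t′

insert-mono {zero} a ()
insert-mono {suc _} a {t} {t′} s o with a <? top t
... | yes a<t rewrite insert-< {t = t′} (subst (a <_) (⟶-top s) a<t) | ⟶-top s =
  gmap (double a (top t′)) under-double (contract-mono s o)
... | no a≮t rewrite insert-≮ {t = t′} (subst (a ≮_) (⟶-top s) a≮t) = under-single s ◅ ε

contract-mono (single-single {t = t}) (_ , t<a , _) rewrite insert-> {t = t} t<a = ε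
contract-mono (single-double {b = b} {t = t}) (_ , a<b , _) rewrite insert-< {t = single b t} a<b = ε
contract-mono (double-single {c = c} {a = a} {t = t} a<c) _
  rewrite insert-≮ {t = single a t} (<⇒≯ a<c) | insert-< {t = single c t} a<c = single-single ◅ ε
contract-mono (double-double-< {c = c} {a = a} {b} {t} a<c c<b) (_ , _ , a<b , _)
  rewrite insert-< {t = double a b t} c<b | insert-< {t = double c b t} a<b = insert-exchange t a<c
contract-mono (double-double-≮ {c = c} {a = a} {b} {t} a<c c≮b) _
  rewrite insert-≮ {t = double a b t} c≮b | insert-< {t = single c (single b t)} a<c =
  single-double ◅ ε
contract-mono (under-single s) _ = s ◅ ε
contract-mono (under-double {a = a} s) (_ , _ , o) = insert-mono a s o

contract-mono* : {t t′ : Filling (suc n)} → t ⟶* t′ → Proper t → contract t ⟶* contract t′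
contract-mono* ε        _ = ε
contract-mono* (s ◅ ss) p = contract-mono s (proj₂ p) ◅◅ contract-mono* ss (⟶-proper s p)

single-⟶*⁻¹ : ∀ {m} {r : Filling n} {t} → top t ≡ m → r ⟶* contract t → single m r ⟶* t
single-⟶*⁻¹ {t = t} refl ss = gmap (single (top t)) under-single ss ◅◅ single-contract-⟶* t

shape-insert : ∀ a (t : Filling n) → shapeOf (insert a t) ▷ shapeOf t
shape-insert a empty = 1∷▷
shape-insert a (single y t) with a <? y
... | yes _ = 2∷▷1∷
... | no  _ = 1∷▷
shape-insert a (double x y t) with a <? y
... | yes _ = 2∷▷2∷ (shape-insert x t)
... | no  _ = 1∷▷

2∷-injective : {u v : Snakeshape n} → 2∷ u ≡ 2∷ v → u ≡ v
2∷-injective refl = refl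

double-injective : ∀ {a a′ b b′} {t t′ : Filling n} →
  double a b t ≡ double a′ b′ t′ → a ≡ a′ × b ≡ b′ × t ≡ t′
double-injective refl = refl , refl , refl

-- The first column of the result reveals the branch taken, and the common shape of `t` and `t′`
-- whether a bottom entry was pushed on into the rest.
insert-injective : ∀ {a a′} (t t′ : Filling n) → shapeOf t ≡ shapeOf t′ →
  insert a t ≡ insert a′ t′ → a ≡ a′ × t ≡ t′
insert-injective empty empty _ refl = refl , refl
insert-injective {a = a} {a′} (single y t) (single y′ t′) _ eq with a <? y | a′ <? y′ | eq
... | yes _ | yes _ | refl = refl , refl
... | yes _ | no  _ | ()
... | no  _ | yes _ | ()
... | no  _ | no  _ | refl = refl , refl
insert-injective {a = a} {a′} (double x y t) (double x′ y′ t′) sh eq with a <? y | a′ <? y′ | eq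
... | no  _ | no  _ | refl = refl , refl
... | yes _ | no  _ | ()
... | no  _ | yes _ | ()
... | yes _ | yes _ | eq′ with double-injective eq′
...   | refl , refl , eq″ with insert-injective t t′ (2∷-injective sh) eq″
...     | refl , refl = refl , refl

-- The derivation of the covering tells where pushing ended; from there the bottom entries move back
-- one column to the left, and `a` comes out.
insert-surjective : {u : Snakeshape n} (s : Filling (suc n)) → Ordered s → shapeOf s ▷ u →
  ∃[ a ] ∃[ t ] shapeOf t ≡ u × insert a t ≡ s
insert-surjective (single a t) (t<a , _) 1∷▷ = a , t , refl , insert-> t<a
insert-surjective (double a b s) (a<b , _) 2∷▷1∷ = a , single b s , refl , insert-< a<b
insert-surjective (double a b s) (a<b , _ , o) (2∷▷2∷ w▷u) with insert-surjective s o w▷u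
... | x , t , refl , refl = a , double x b t , refl , insert-< a<b

contract-injective : {u : Snakeshape n} (t t′ : Filling (2 + n)) →
  shapeOf t ≡ 2∷ u → shapeOf t′ ≡ 2∷ u → top t ≡ top t′ → contract t ≡ contract t′ → t ≡ t′
contract-injective (double _ _ t) (double _ _ t′) refl sh refl eq
  with insert-injective t t′ (sym (2∷-injective sh)) eq
... | refl , refl = refl

-- Tableaux above a given one

-- An inductive substitute for being row canonical: it passes to tails, and it forbids shifting an
-- entry into a two-boxed first column.
MinimalBottoms : Filling n → Set
MinimalBottoms empty          = ⊤
MinimalBottoms (single _ t)   = MinimalBottoms t
MinimalBottoms (double a _ t) = All (a ≤_) (entries t) × MinimalBottoms t

-- A shift into the first column needs an entry of `r` smaller than `a`, and shifts inside `r` only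
-- permute its entries.
double-⟶* : ∀ {a b} {r : Filling n} {t} → All (a ≤_) (entries r) → double a b r ⟶* t →
  ∃[ t′ ] double a b t′ ≡ t × r ⟶* t′
double-⟶* _ ε = _ , refl , ε
double-⟶* (c≤a ∷ _) (double-single a<c ◅ _) = ⊥-elim (≤⇒≯ c≤a a<c)
double-⟶* (c≤a ∷ _) (double-double-< a<c _ ◅ _) = ⊥-elim (≤⇒≯ c≤a a<c)
double-⟶* (c≤a ∷ _) (double-double-≮ a<c _ ◅ _) = ⊥-elim (≤⇒≯ c≤a a<c)
double-⟶* a≤r (under-double s ◅ ss) =
  let t′ , eq , ss′ = double-⟶* (All-resp-↭ (⟶-entries s) a≤r) ss in t′ , eq , s ◅ ss′

-- The induction is on `r`, since the recurrence for `K (2∷ u) (1∷ v)` leads to covers of `u`, which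
-- are not parts of `2∷ u`.
count-above : (u : Snakeshape n) (r : Filling n) → Proper r → MinimalBottoms r →
  Count (λ t → shapeOf t ≡ u × r ⟶* t) (K u (shapeOf r))
count-above ∅ empty _ _ =
  empty ∷ [] , [] ∷ [] , (λ { empty → mk⇔ (λ _ → refl , ε) (λ _ → here refl) }) , refl
count-above (1∷ u) (single m r) p@(_ ∷ r! , _ , o) min =
  count-transport (λ t t′ → single m t ≡ t′)
    (λ { refl refl → refl })
    (λ { refl refl _ _ → refl })
    (λ { (refl , ss) → _ , (refl , gmap (single m) under-single ss) , refl })
    (λ { {single m′ t} (refl , ss) →
         t , (refl , contract-mono* ss p) , cong (λ k → single k t) (⟶*-top ss) })
    (count-above u r (r! , o) min)
count-above (2∷ u) (double a b r) (_ ∷ _ ∷ r! , _ , _ , o) (a≤r , min) =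
  count-transport (λ t t′ → double a b t ≡ t′)
    (λ { refl refl → refl })
    (λ { refl refl _ _ → refl })
    (λ { (refl , ss) → _ , (refl , gmap (double a b) under-double ss) , refl })
    (λ { (sh , ss) → let t , eq , ss′ = double-⟶* a≤r ss
                     in t , (2∷-injective (trans (cong shapeOf eq) sh) , ss′) , eq })
    (count-above u r (r! , o) min)
count-above (1∷ u) (double a b r) _ (a≤r , _) =
  count-∅ (λ { t (sh , ss) → case-double (double-⟶* a≤r ss) sh })
  where
  case-double : ∀ {t} → ∃[ t′ ] double a b t′ ≡ t × r ⟶* t′ → shapeOf t ≢ 1∷ u
  case-double (_ , refl , _) ()
count-above (2∷ u) (single m r) p@(_ ∷ r! , _ , o) min =
  count-transport (λ s t → contract t ≡ s)
    (λ { refl refl → refl })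
    -- Both top entries equal `m`, since shifts from `single m r` keep it.
    (λ { {_} {t} {t′} refl eq (sh , ss) (sh′ , ss′) →
         contract-injective t t′ sh sh′ (trans (sym (⟶*-top ss)) (⟶*-top ss′)) (sym eq) })
    (λ { {s} (s∈ , ss) →
         let a , t , sh , eq = insert-surjective s (proj₂ (⟶*-proper ss (r! , o))) (∈covers⇒▷ s∈)
         -- The top entry `m` is forced, and `a` is the entry whose insertion into `t` gives `s`.
         in double a m t
          , (cong 2∷_ sh , single-⟶*⁻¹ refl (subst (r ⟶*_) (sym eq) ss))
          , eq })
    (λ { {double a _ t} (refl , ss) →
         insert a t , (▷⇒∈covers (shape-insert a t) , contract-mono* ss p) , refl })
    (count-fibres shapeOf (λ w → count-above w r (r! , o) min) (covers-unique u))

-- Row canonical tableaux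

shape-row : ∀ top bottom (v : Snakeshape n) → shapeOf (rowFilling top bottom v) ≡ v
shape-row _ _ ∅      = refl
shape-row _ _ (1∷ v) = cong 1∷_ (shape-row _ _ v)
shape-row _ _ (2∷ v) = cong 2∷_ (shape-row _ _ v)

row-≥bottom : ∀ {k} b (v : Snakeshape n) → k ≡ b + n → All (suc b ≤_) (entries (rowFilling k (suc b) v))
row-≥bottom b ∅ _ = []
row-≥bottom {suc n} b (1∷ v) refl rewrite +-suc b n = s≤s (m≤m+n b n) ∷ row-≥bottom b v refl
row-≥bottom {suc (suc n)} b (2∷ v) refl rewrite +-suc b (suc n) | +-suc b n =
  ≤-refl ∷ s≤s (m≤n⇒m≤1+n (m≤m+n b n)) ∷ All.map <⇒≤ (row-≥bottom (suc b) v refl)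

row-minimalBottoms : ∀ {k} b (v : Snakeshape n) → k ≡ b + n → MinimalBottoms (rowFilling k (suc b) v)
row-minimalBottoms b ∅ _ = tt
row-minimalBottoms {suc n} b (1∷ v) refl rewrite +-suc b n = row-minimalBottoms b v refl
row-minimalBottoms {suc (suc n)} b (2∷ v) refl rewrite +-suc b (suc n) | +-suc b n =
  All.map <⇒≤ (row-≥bottom (suc b) v refl) , row-minimalBottoms (suc b) v refl

theorem6p2 : ∀ (n : ℕ) → n ≥ 1 → (u v : Snakeshape n) →
    (1̂ : YFT n) → Maximum _⪯_ 1̂ →
    Count (λ t → shape t ≡ u × t ∈[ rT v , 1̂ ]) (K u v)
theorem6p2 n _ u v 1̂ max =
  count-transport (λ t t′ → filling t′ ≡ t)
    (λ { refl refl → refl })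
    (λ { refl refl _ _ → refl })
    -- The upper end of the interval comes from `max`.
    (λ { (sh , ss) → let t , eq , above = ⟶*⇒⪯ (rT v) ss
                     in t , (trans (cong shapeOf eq) sh , above , max t) , eq })
    (λ { {t} (sh , above , _) → filling t , (sh , ⪯⇒⟶* above) , refl })
    (subst (λ w → Count (λ t → shapeOf t ≡ u × rowFilling n 1 v ⟶* t) (K u w)) (shape-row n 1 v)
      (count-above u (rowFilling n 1 v) (standard⇒proper (rowFilling-standard v))
        (row-minimalBottoms 0 v refl)))
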